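{- Let $t,s$ be integers with $4 \leq t \leq s \leq \frac{13t+37}{2}$ and let $G=C_3^tC_4^s$. Then $G$ is graceful when $t\equiv 0,1\pmod 4$ and near graceful when $t\equiv 2,3\pmod 4$.
   Context: $C_n^t$ denotes the union of $t$ cycles of length $n$ sharing exactly one common (central) vertex, and $C_3^tC_4^s$ denotes the graph obtained by identifying the central vertices of $C_3^t$ and $C_4^s$. For a graph $G$ with $m$ edges, a graceful labelling is an injective map $f:V(G)\to\{0,\ldots,m\}$ such that $g(uv)=|f(u)-f(v)|$ is a bijection $E(G)\to\{1,\ldots,m\}$. A near graceful labelling is an injective map $f:V(G)\to\{0,\ldots,m+1\}$ such that $g(uv)=|f(u)-f(v)|$ is a bijection onto $\{1,\ldots,m-1,m\}$ or onto $\{1,\ldots,m-1,m+1\}$. A graph is (near) graceful if it admits such a labelling. -}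

module Defs where

open import Data.Nat using (ℕ; zero; suc; _+_; _*_; _∸_; _≤_; ∣_-_∣)
open import Data.Fin using (Fin; zero; suc)
open import Data.Product using (_×_; _,_; ∃)
open import Data.Sum using (_⊎_)
open import Relation.Binary.PropositionalEquality using (_≡_)
open import Function.Definitions using (Injective)

record Graph : Set₁ where
  field
    Vertex : Set
    Edge   : Set
    ends   : Edge → Vertex × Vertex

open Graph public

-- The graph C_3^t C_4^s : a central vertex, t triangles and s 4-cycles,
-- all sharing only the central vertex.
data V (t s : ℕ) : Set where
  centre : V t s
  triV   : Fin t → Fin 2 → V t s
  sqV    : Fin s → Fin 3 → V t s

data E (t s : ℕ) : Set where
  triE : Fin t → Fin 3 → E t s
  sqE  : Fin s → Fin 4 → E t s

endsCS : ∀ {t s} → E t s → V t s × V t s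
endsCS (triE i zero)                   = centre , triV i zero
endsCS (triE i (suc zero))             = triV i zero , triV i (suc zero)
endsCS (triE i (suc (suc zero)))       = triV i (suc zero) , centre
endsCS (sqE i zero)                    = centre , sqV i zero
endsCS (sqE i (suc zero))              = sqV i zero , sqV i (suc zero)
endsCS (sqE i (suc (suc zero)))        = sqV i (suc zero) , sqV i (suc (suc zero))
endsCS (sqE i (suc (suc (suc zero))))  = sqV i (suc (suc zero)) , centre

C3C4 : ℕ → ℕ → Graph
C3C4 t s = record { Vertex = V t s ; Edge = E t s ; ends = endsCS }

edgesC3C4 : ℕ → ℕ → ℕ
edgesC3C4 t s = 3 * t + 4 * s

edgeLabel : (G : Graph) → (Vertex G → ℕ) → Edge G → ℕ
edgeLabel G f e with ends G e
... | (u , v) = ∣ f u - f v ∣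

BijOnto : {A : Set} → (A → ℕ) → (ℕ → Set) → Set
BijOnto {A} g P = Injective _≡_ _≡_ g × (∀ a → P (g a)) × (∀ k → P k → ∃ λ a → g a ≡ k)

IsGraceful : (G : Graph) → (m : ℕ) → (Vertex G → ℕ) → Set
IsGraceful G m f =
  Injective _≡_ _≡_ f × (∀ v → f v ≤ m) ×
  BijOnto (edgeLabel G f) (λ k → 1 ≤ k × k ≤ m)

Graceful : Graph → ℕ → Set
Graceful G m = ∃ λ (f : Vertex G → ℕ) → IsGraceful G m f

IsNearGraceful : (G : Graph) → (m : ℕ) → (Vertex G → ℕ) → Set
IsNearGraceful G m f =
  Injective _≡_ _≡_ f × (∀ v → f v ≤ suc m) ×
  (BijOnto (edgeLabel G f) (λ k → 1 ≤ k × k ≤ m)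
   ⊎ BijOnto (edgeLabel G f) (λ k → (1 ≤ k × k ≤ m ∸ 1) ⊎ k ≡ suc m))

NearGraceful : Graph → ℕ → Set
NearGraceful G m = ∃ λ (f : Vertex G → ℕ) → IsNearGraceful G m f

{-# OPTIONS --safe #-}
module Submission where

-- The centre gets label 0, so the neighbours of the centre are labelled by their spokes.
-- A triangle 0, p, p + d has edge labels p, p + d, d; a Skolem sequence (hooked if
-- t ≡ 2, 3 mod 4) moved to the top of the label range gives t triangles with edge labels
-- 1, …, t and t + 4s + 1, …, m (with m replaced by m + 1 in the hooked case).
-- The 4-cycles use t + 1, …, t + 4s.  If y is opposite the centre, the edge labels of the
-- cycle form two pairs, each of sum y or of difference y.  The first 4a of these labels
-- are grouped into pairs of equal sum, two for each y; the next 4q are grouped into pairs of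
-- equal difference, two for each of y = q + 1, q + 3, …, 3q - 1; what remains is at most two
-- blocks of four labels, with y = 1 and y = 2.
-- When t + 2a ≤ q ≤ t + 4a + 1, each y is also the label of an edge off the centre,
-- so it is not the label of a neighbour of the centre; and the y are distinct if
-- a = 0 or q is odd.  Such a and q are found by induction on s - t.

open import Defs
open import Data.Nat using (ℕ; zero; suc; _+_; _*_; _∸_; _≤_; _<_; _%_; _/_; z≤n; s≤s; z<s; ∣_-_∣; _≟_; _<?_)
open import Data.Nat.DivMod using (m≡m%n+[m/n]*n; m≥n⇒m/n>0)
open import Data.Nat.ListAction using (sum)
open import Data.Nat.Properties hiding (_≟_; _<?_)
open import Data.Nat.Tactic.RingSolver using (solve; solve-∀)
open import Data.Fin using (Fin; zero; suc; toℕ; fromℕ<; punchIn; punchOut; join; splitAt; combine)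
open import Data.Fin.Properties using (any?; injective⇒≤; punchOut-injective; punchIn-injective; punchInᵢ≢i; toℕ<n; toℕ-injective; toℕ-fromℕ<; splitAt-join; combine-injective) renaming (_≟_ to _≟ᶠ_)
open import Data.List using (List; []; _∷_; _++_; length; lookup; map; concatMap; applyUpTo; take)
open import Data.List.Properties using (length-++; length-map; length-applyUpTo)
open import Data.List.Membership.Propositional using (_∈_; lose)
open import Data.List.Membership.Propositional.Properties using (∈-lookup)
open import Data.List.Relation.Unary.All using (All)
import Data.List.Relation.Unary.All as All
import Data.List.Relation.Unary.All.Properties as All
open import Data.List.Relation.Unary.AllPairs using (AllPairs)
import Data.List.Relation.Unary.AllPairs as AllPairs
import Data.List.Relation.Unary.AllPairs.Properties as AllPairs
open import Data.List.Relation.Unary.Any using (Any; here; there; index)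
import Data.List.Relation.Unary.Any as Any
import Data.List.Relation.Unary.Any.Properties as Any
open import Data.Product using (∃; _×_; _,_; proj₁; proj₂)
open import Data.Sum using (_⊎_; inj₁; inj₂; [_,_]′)
import Data.Sum as Sum
open import Data.Sum.Properties using (inj₁-injective; inj₂-injective)
open import Function using (_∘_; Injective)
open import Relation.Binary.PropositionalEquality
open import Relation.Nullary using (¬_; yes; no; contradiction)

-- Counting

injective⇒surjective : ∀ {n} {f : Fin n → Fin n} → Injective _≡_ _≡_ f →
                       ∀ j → ∃ λ i → f i ≡ j
injective⇒surjective {suc n} {f} f-inj j with any? (λ i → f i ≟ᶠ j)
... | yes hit = hit
... | no miss = contradiction
  (injective⇒≤ {f = λ i → punchOut (avoids i)} λ eq → f-inj (punchOut-injective (avoids _) (avoids _) eq))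
  1+n≰n
  where
  avoids : ∀ i → j ≢ f i
  avoids i j≡fi = miss (i , sym j≡fi)

-- Choosing a preimage for each of the `m` distinct values embeds `Fin m` in `E`. Followed by `ι`
-- this is an injection of `Fin m` into itself, hence onto, so every element of `E` is a chosen
-- preimage. Thus it suffices to show that every wanted edge label occurs: injectivity and the
-- absence of other labels follow.
module _ {E : Set} {m : ℕ} (ι : E → Fin m) (ι-injective : Injective _≡_ _≡_ ι)
         (g : E → ℕ) (value : Fin m → ℕ) (value-injective : Injective _≡_ _≡_ value)
         (hit : ∀ j → ∃ λ e → g e ≡ value j) where

  private
    preimage : Fin m → E
    preimage j = proj₁ (hit j)

    preimage-injective : Injective _≡_ _≡_ preimage
    preimage-injective {j} {k} eq =
      value-injective (trans (sym (proj₂ (hit j))) (trans (cong g eq) (proj₂ (hit k))))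

    preimage-onto : ∀ e → ∃ λ j → preimage j ≡ e
    preimage-onto e with injective⇒surjective (preimage-injective ∘ ι-injective) (ι e)
    ... | j , eq = j , ι-injective eq

  onto⇒image : ∀ e → ∃ λ j → g e ≡ value j
  onto⇒image e with preimage-onto e
  ... | j , refl = j , proj₂ (hit j)

  onto⇒injective : Injective _≡_ _≡_ g
  onto⇒injective {e} {e′} eq with preimage-onto e | preimage-onto e′
  ... | j , refl | k , refl =
    cong preimage (value-injective (trans (sym (proj₂ (hit j))) (trans eq (proj₂ (hit k)))))

join-injective : ∀ m n → Injective _≡_ _≡_ (join m n)
join-injective m n {x} {y} eq =
  trans (sym (splitAt-join m n x)) (trans (cong (splitAt m) eq) (splitAt-join m n y))

edgeIndex : ∀ {t s} → E t s → Fin (edgesC3C4 t s)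
edgeIndex {t} {s} (triE i k) = join (3 * t) (4 * s) (inj₁ (combine k i))
edgeIndex {t} {s} (sqE i k)  = join (3 * t) (4 * s) (inj₂ (combine k i))

edgeIndex-injective : ∀ {t s} → Injective _≡_ _≡_ (edgeIndex {t} {s})
edgeIndex-injective {t} {s} {triE i k} {triE j l} eq
  with refl , refl ← combine-injective k i l j (inj₁-injective (join-injective (3 * t) (4 * s) eq)) = refl
edgeIndex-injective {t} {s} {sqE i k} {sqE j l} eq
  with refl , refl ← combine-injective k i l j (inj₂-injective (join-injective (3 * t) (4 * s) eq)) = refl
edgeIndex-injective {t} {s} {triE i k} {sqE j l} eq
  with () ← join-injective (3 * t) (4 * s) {inj₁ (combine k i)} {inj₂ (combine l j)} eq
edgeIndex-injective {t} {s} {sqE i k} {triE j l} eq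
  with () ← join-injective (3 * t) (4 * s) {inj₂ (combine k i)} {inj₁ (combine l j)} eq

-- Labellings with central label 0

-- {1, …, m + 1} without h + 1: the edge labels of a graceful labelling for h = m,
-- of a near graceful one for h = m ∸ 1.
Range : ℕ → ℕ → ℕ → Set
Range m h k = 1 ≤ k × k ≤ suc m × k ≢ suc h

module _ {m h : ℕ} (h≤m : h ≤ m) where

  private
    hole : Fin (suc m)
    hole = fromℕ< (s≤s h≤m)

  rangeValue : Fin m → ℕ
  rangeValue j = suc (toℕ (punchIn hole j))

  rangeValue-injective : Injective _≡_ _≡_ rangeValue
  rangeValue-injective eq = punchIn-injective hole _ _ (toℕ-injective (suc-injective eq))

  rangeValue-∈ : ∀ j → Range m h (rangeValue j)
  rangeValue-∈ j = s≤s z≤n , toℕ<n (punchIn hole j) , λ eq →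
    punchInᵢ≢i hole j (toℕ-injective (trans (suc-injective eq) (sym (toℕ-fromℕ< (s≤s h≤m)))))

-- The labels of a 4-cycle through the centre: its two neighbours of the centre,
-- the vertex opposite the centre, and the two edges off the centre.
record Square : Set where
  field
    nbr₁ nbr₂ opp inner₁ inner₂ : ℕ
    side₁ : ∣ nbr₁ - opp ∣ ≡ inner₁
    side₂ : ∣ opp - nbr₂ ∣ ≡ inner₂

open Square

-- A pair (p , d) stands for a triangle with labels 0, p, p + d.
Pos Diff : List (ℕ × ℕ) → ℕ → Set
Pos  T k = Any (λ τ → proj₁ τ ≡ k ⊎ proj₁ τ + proj₂ τ ≡ k) T
Diff T k = Any (λ τ → proj₂ τ ≡ k) T

Outer Inner SquareLabel : List Square → ℕ → Set
Outer S k = Any (λ c → nbr₁ c ≡ k ⊎ nbr₂ c ≡ k) S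
Inner S k = Any (λ c → inner₁ c ≡ k ⊎ inner₂ c ≡ k) S
SquareLabel S k = Outer S k ⊎ Inner S k

AllPairs-lookup : ∀ {A : Set} {f : A → ℕ} {xs : List A} → AllPairs (λ x y → f x ≢ f y) xs →
                  ∀ i j → f (lookup xs i) ≡ f (lookup xs j) → i ≡ j
AllPairs-lookup (_ AllPairs.∷ _)  zero    zero    _  = refl
AllPairs-lookup (d AllPairs.∷ _)  zero    (suc j) eq = contradiction eq (All.lookup d (∈-lookup j))
AllPairs-lookup (d AllPairs.∷ _)  (suc i) zero    eq = contradiction (sym eq) (All.lookup d (∈-lookup i))
AllPairs-lookup (_ AllPairs.∷ ds) (suc i) (suc j) eq = cong suc (AllPairs-lookup ds i j eq)

module Labelling (T : List (ℕ × ℕ)) (S : List Square) where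

  private
    t = length T
    s = length S
    m = edgesC3C4 t s

  labelling : V t s → ℕ
  labelling centre                   = 0
  labelling (triV i zero)            = proj₁ (lookup T i)
  labelling (triV i (suc zero))      = proj₁ (lookup T i) + proj₂ (lookup T i)
  labelling (sqV i zero)             = nbr₁ (lookup S i)
  labelling (sqV i (suc zero))       = opp (lookup S i)
  labelling (sqV i (suc (suc zero))) = nbr₂ (lookup S i)

  private
    label : E t s → ℕ
    label = edgeLabel (C3C4 t s) labelling

  -- As the centre has label 0, a spoke and its outer end carry the same label. Through this
  -- relation, injectivity on edges yields injectivity on vertices.
  data Spoke : E t s → V t s → Set where
    tri₀ : ∀ i → Spoke (triE i zero) (triV i zero)
    tri₁ : ∀ i → Spoke (triE i (suc (suc zero))) (triV i (suc zero))
    sq₀  : ∀ i → Spoke (sqE i zero) (sqV i zero)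
    sq₂  : ∀ i → Spoke (sqE i (suc (suc (suc zero)))) (sqV i (suc (suc zero)))

  spoke-label : ∀ {e v} → Spoke e v → label e ≡ labelling v
  spoke-label (tri₀ i) = refl
  spoke-label (tri₁ i) = ∣-∣-identityʳ _
  spoke-label (sq₀ i)  = refl
  spoke-label (sq₂ i)  = ∣-∣-identityʳ _

  spoke-functional : ∀ {e v w} → Spoke e v → Spoke e w → v ≡ w
  spoke-functional (tri₀ _) (tri₀ _) = refl
  spoke-functional (tri₁ _) (tri₁ _) = refl
  spoke-functional (sq₀ _)  (sq₀ _)  = refl
  spoke-functional (sq₂ _)  (sq₂ _)  = refl

  data VertexView : V t s → Set where
    atCentre : VertexView centre
    onSpoke  : ∀ {e v} → Spoke e v → VertexView v
    opposite : ∀ i → VertexView (sqV i (suc zero))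

  view : ∀ v → VertexView v
  view centre                   = atCentre
  view (triV i zero)            = onSpoke (tri₀ i)
  view (triV i (suc zero))      = onSpoke (tri₁ i)
  view (sqV i zero)             = onSpoke (sq₀ i)
  view (sqV i (suc zero))       = opposite i
  view (sqV i (suc (suc zero))) = onSpoke (sq₂ i)

  Rim : E t s → Set
  Rim e = ∀ {v} → ¬ Spoke e v

  InnerLabel OuterLabel : ℕ → Set
  InnerLabel k = Diff T k ⊎ Inner S k
  OuterLabel k = Pos T k ⊎ Outer S k

  inner-edge : ∀ {k} → InnerLabel k → ∃ λ e → label e ≡ k × Rim e
  inner-edge (inj₁ p) =
    triE (index p) (suc zero) , trans (∣m-m+n∣≡n (proj₁ (lookup T (index p))) _) (Any.lookup-index p) , λ ()
  inner-edge (inj₂ p) with Any.lookup-index p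
  ... | inj₁ eq = sqE (index p) (suc zero) , trans (side₁ (lookup S (index p))) eq , λ ()
  ... | inj₂ eq = sqE (index p) (suc (suc zero)) , trans (side₂ (lookup S (index p))) eq , λ ()

  outer-edge : ∀ {k} → OuterLabel k → ∃ λ e → label e ≡ k
  outer-edge (inj₁ p) with Any.lookup-index p
  ... | inj₁ eq = triE (index p) zero , eq
  ... | inj₂ eq = triE (index p) (suc (suc zero)) , trans (∣-∣-identityʳ _) eq
  outer-edge (inj₂ p) with Any.lookup-index p
  ... | inj₁ eq = sqE (index p) zero , eq
  ... | inj₂ eq = sqE (index p) (suc (suc (suc zero))) , trans (∣-∣-identityʳ _) eq

  -- `cover` alone makes the edge labels bijective, by counting. The hypotheses on `opp` serve the
  -- vertices: the opposite vertices are the only ones other than the centre that are not ends of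
  -- spokes.
  module _ {h : ℕ} (h≤m : h ≤ m)
           (cover : ∀ {k} → Range m h k → OuterLabel k ⊎ InnerLabel k)
           (opp-distinct : AllPairs (λ c d → opp c ≢ opp d) S)
           (opp-inner : All (λ c → InnerLabel (opp c)) S) where

    private
      hit : ∀ {k} → Range m h k → ∃ λ e → label e ≡ k
      hit r with cover r
      ... | inj₁ o = outer-edge o
      ... | inj₂ i with inner-edge i
      ...   | e , eq , _ = e , eq

      hit-value : ∀ j → ∃ λ e → label e ≡ rangeValue h≤m j
      hit-value j = hit (rangeValue-∈ h≤m j)

      label-injective : Injective _≡_ _≡_ label
      label-injective = onto⇒injective edgeIndex edgeIndex-injective label
        (rangeValue h≤m) (rangeValue-injective h≤m) hit-value

      label-range : ∀ e → Range m h (label e)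
      label-range e =
        let j , eq = onto⇒image edgeIndex edgeIndex-injective label
                       (rangeValue h≤m) (rangeValue-injective h≤m) hit-value e
        in subst (Range m h) (sym eq) (rangeValue-∈ h≤m j)

      opp-edge : ∀ i → ∃ λ e → label e ≡ opp (lookup S i) × Rim e
      opp-edge i = inner-edge (All.lookup opp-inner (∈-lookup i))

    label-bijective : BijOnto label (Range m h)
    label-bijective = label-injective , label-range , λ k → hit

    labelling-range : ∀ v → labelling v ≡ 0 ⊎ Range m h (labelling v)
    labelling-range v with view v
    ... | atCentre = inj₁ refl
    ... | onSpoke {e} σ = inj₂ (subst (Range m h) (spoke-label σ) (label-range e))
    ... | opposite i with opp-edge i
    ...   | e , eq , _ = inj₂ (subst (Range m h) eq (label-range e))

    -- The opposite labels also label edges off the centre, so injectivity of the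
    -- edge labels keeps them apart from the neighbours of the centre.
    labelling-injective : Injective _≡_ _≡_ labelling
    labelling-injective {v} {w} eq = go (view v) (view w) eq
      where
      spoke≢0 : ∀ {e v} → Spoke e v → 0 ≢ labelling v
      spoke≢0 {e} σ eq = <⇒≢ (proj₁ (label-range e)) (trans eq (sym (spoke-label σ)))

      opp≢0 : ∀ i → 0 ≢ opp (lookup S i)
      opp≢0 i eq with opp-edge i
      ... | e , eq′ , _ = <⇒≢ (proj₁ (label-range e)) (trans eq (sym eq′))

      apart : ∀ {e v} i → Spoke e v → opp (lookup S i) ≢ labelling v
      apart {e} {v} i σ eq = let e′ , eq′ , rim = opp-edge i in
        rim (subst (λ e → Spoke e v)
          (label-injective {e} {e′} (trans (spoke-label σ) (trans (sym eq) (sym eq′)))) σ)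

      go : ∀ {v w} → VertexView v → VertexView w → labelling v ≡ labelling w → v ≡ w
      go atCentre     atCentre     _  = refl
      go atCentre     (onSpoke σ)  eq = contradiction eq (spoke≢0 σ)
      go atCentre     (opposite i) eq = contradiction eq (opp≢0 i)
      go (onSpoke σ)  atCentre     eq = contradiction (sym eq) (spoke≢0 σ)
      go {v} (onSpoke {e} σ) (onSpoke {e′} τ) eq = spoke-functional
        (subst (λ e → Spoke e v)
          (label-injective {e} {e′} (trans (spoke-label σ) (trans eq (sym (spoke-label τ))))) σ) τ
      go (onSpoke σ)  (opposite i) eq = contradiction (sym eq) (apart i σ)
      go (opposite i) atCentre     eq = contradiction (sym eq) (opp≢0 i)
      go (opposite i) (onSpoke σ)  eq = contradiction eq (apart i σ)
      go (opposite i) (opposite j) eq = cong (λ i → sqV i (suc zero)) (AllPairs-lookup opp-distinct i j eq)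

-- Runs of consecutive labels

record Run (P : ℕ → Set) (lo n : ℕ) : Set where
  constructor run
  field at : ∀ {i} → i < n → P (lo + i)

open Run

chain : ∀ {P lo lo′ n n′} → Run P lo n → Run P lo′ n′ → lo + n ≡ lo′ → Run P lo (n + n′)
chain {P} {lo} {n = n} {n′} r r′ refl .at {i} i<n+n′ with i <? n
... | yes i<n = r .at i<n
... | no  i≮n with j , refl ← m≤n⇒∃[o]m+o≡n (≮⇒≥ i≮n) =
  subst P (+-assoc lo n j) (r′ .at (+-cancelˡ-< n j n′ i<n+n′))

infixr 5 chain
syntax chain r r′ eq = r ∙⟨ eq ⟩ r′

resize : ∀ {P lo n n′} → Run P lo n → n ≡ n′ → Run P lo n′
resize r refl = r

inside : ∀ {P lo n x} → Run P lo n → lo ≤ x → x < lo + n → P x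
inside {lo = lo} {n} r lo≤x x<hi with j , refl ← m≤n⇒∃[o]m+o≡n lo≤x = r .at (+-cancelˡ-< lo j n x<hi)

half : ∀ n → ∃ λ j → n ≡ 2 * j ⊎ n ≡ suc (2 * j)
half zero          = 0 , inj₁ refl
half (suc zero)    = 0 , inj₂ refl
half (suc (suc n)) with half n
... | j , inj₁ refl = suc j , inj₁ (sym (*-suc 2 j))
... | j , inj₂ refl = suc j , inj₂ (cong suc (sym (*-suc 2 j)))

-- From `o ≤ e` follows `e + o ≤ 2 * e`, so an even index `2 * j` below `e + o` has `j < e`. From
-- `e ≤ suc o` follows `e + o ≤ suc (2 * o)`, which settles the odd indices.
interleave : ∀ {P lo e o} → Run (λ j → P (lo + 2 * j)) 0 e → Run (λ j → P (lo + suc (2 * j))) 0 o →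
             o ≤ e → e ≤ suc o → Run P lo (e + o)
interleave {e = e} {o} evens odds o≤e e≤1+o .at {i} i<e+o with half i
... | j , inj₁ refl = evens .at (*-cancelˡ-< 2 j e (<-≤-trans i<e+o
  (+-monoʳ-≤ e (≤-trans o≤e (m≤m+n e 0)))))
... | j , inj₂ refl = odds .at (*-cancelˡ-< 2 j o (≤-pred (<-≤-trans i<e+o
  (+-mono-≤ e≤1+o (m≤m+n o 0)))))

-- The witness is `n - 1 - j`. It serves to read backwards a list whose entries depend on
-- `n ∸ suc i`.
reflect : ∀ {n j} → j < n → ∃ λ i → i < n × n ∸ suc i ≡ j × i + suc j ≡ n
reflect {n} {j} j<n with i , refl ← m≤n⇒∃[o]m+o≡n j<n =
  i , s≤s (m≤n+m i j) , trans (cong (_∸ i) (+-comm j i)) (m+n∸m≡n i j) , trans (+-suc i j) (cong suc (+-comm i j))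

-- Skolem sequences

-- Positions count from 0.  The hole is 2 t for a Skolem sequence, 2 t ∸ 1 for a hooked one.
record Skolem (t hole : ℕ) : Set where
  field
    pairs  : List (ℕ × ℕ)
    size   : length pairs ≡ t
    diffs  : Run (λ x → Diff pairs (suc x)) 0 t
    covers : ∀ {x} → x ≤ 2 * t → x ≢ hole → Pos pairs x

record Nest : Set where
  constructor nest
  field
    start gap depth : ℕ

open Nest

-- The pairs of a nest are concentric; the outermost starts at `start`, the innermost
-- encloses `gap` positions.
expand : Nest → List (ℕ × ℕ)
expand (nest p g n) = applyUpTo (λ i → p + i , suc (g + 2 * (n ∸ suc i))) n

module Nests (ns : List Nest) where

  pairs : List (ℕ × ℕ)
  pairs = concatMap expand ns

  private
    pick : ∀ {P : ℕ × ℕ → Set} {N i} → N ∈ ns → i < depth N →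
           P (start N + i , suc (gap N + 2 * (depth N ∸ suc i))) → Any P pairs
    pick N∈ns i<n q = Any.concatMap⁺ expand (lose N∈ns (Any.applyUpTo⁺ _ q i<n))

  left : ∀ {p g n} → nest p g n ∈ ns → Run (Pos pairs) p n
  left N∈ns .at i<n = pick N∈ns i<n (inj₁ refl)

  -- Right ends ascend as the pairs are taken from the inside out; the innermost one ends at
  -- `p + n + g`.
  right : ∀ {p g n} → nest p g n ∈ ns → Run (Pos pairs) (p + n + g) n
  right {p} {g} {n} N∈ns .at {j} j<n with i , i<n , mirror , i+1+j≡n ← reflect j<n =
    pick N∈ns i<n (inj₂ (begin
      p + i + suc (g + 2 * (n ∸ suc i)) ≡⟨ cong (λ h → p + i + suc (g + 2 * h)) mirror ⟩
      p + i + suc (g + 2 * j)           ≡⟨ solve (p ∷ i ∷ g ∷ j ∷ []) ⟩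
      p + (i + suc j) + g + j           ≡⟨ cong (λ h → p + h + g + j) i+1+j≡n ⟩
      p + n + g + j                     ∎))
    where open ≡-Reasoning

  private
    diff : ∀ {p g n} → nest p g n ∈ ns → ∀ {j} → j < n → Diff pairs (suc (g + 2 * j))
    diff {g = g} N∈ns j<n with i , i<n , mirror , _ ← reflect j<n =
      pick N∈ns i<n (cong (λ h → suc (g + 2 * h)) mirror)

  -- Within a nest the differences are `g + 1`, `g + 3`, and so on, so the parity of the gap fixes
  -- theirs. The odd and the even differences are collected as separate runs, to be joined by
  -- `interleave`.
  odd : ∀ h {p n} → nest p (2 * h) n ∈ ns → Run (λ j → Diff pairs (suc (2 * j))) h n
  odd h N∈ns .at {j} j<n = subst (Diff pairs ∘ suc) (sym (*-distribˡ-+ 2 h j)) (diff N∈ns j<n)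

  even : ∀ h {p n} → nest p (suc (2 * h)) n ∈ ns → Run (λ j → Diff pairs (suc (suc (2 * j)))) h n
  even h N∈ns .at {j} j<n = subst (λ x → Diff pairs (2 + x)) (sym (*-distribˡ-+ 2 h j)) (diff N∈ns j<n)

  length-pairs : length pairs ≡ sum (map depth ns)
  length-pairs = go ns
    where
    go : ∀ ns → length (concatMap expand ns) ≡ sum (map depth ns)
    go []       = refl
    go (N ∷ ns) = trans (length-++ (expand N)) (cong₂ _+_ (length-applyUpTo _ (depth N)) (go ns))

unhooked-covers : ∀ {P n} → Run P 0 n → ∀ {x} → x ≤ n → x ≢ n → P x
unhooked-covers r x≤n x≢n = r .at (≤∧≢⇒< x≤n x≢n)

hooked-covers : ∀ {P n h} → Run P 0 h → P (suc h) → n ≡ suc h → ∀ {x} → x ≤ n → x ≢ h → P x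
hooked-covers {h = h} r hook refl {x} x≤n x≢h with x ≟ suc h
... | yes refl = hook
... | no x≢n   = r .at (≤∧≢⇒< (≤-pred (≤∧≢⇒< x≤n x≢n)) x≢h)

pattern #0 = here refl
pattern #1 = there #0
pattern #2 = there #1
pattern #3 = there #2
pattern #4 = there #3
pattern #5 = there #4
pattern #6 = there #5

-- The sequence 1 1 4 2 3 2 4 3.
skolem-4 : Skolem 4 8
skolem-4 = record
  { pairs  = pairs
  ; size   = refl
  ; diffs  = interleave (odd 0 #0 ∙⟨ refl ⟩ odd 1 #2) (even 0 #1 ∙⟨ refl ⟩ even 1 #3) ≤-refl (n≤1+n _)
  ; covers = unhooked-covers
      (left #0 ∙⟨ refl ⟩ right #0 ∙⟨ refl ⟩ left #3 ∙⟨ refl ⟩ left #1 ∙⟨ refl ⟩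
       left #2 ∙⟨ refl ⟩ right #1 ∙⟨ refl ⟩ right #3 ∙⟨ refl ⟩ right #2)
  }
  where
  open Nests (nest 0 0 1 ∷ nest 3 1 1 ∷ nest 4 2 1 ∷ nest 2 3 1 ∷ [])

-- The sequence 1 1 3 4 5 3 2 4 2 5.
skolem-5 : Skolem 5 10
skolem-5 = record
  { pairs  = pairs
  ; size   = refl
  ; diffs  = interleave (odd 0 #0 ∙⟨ refl ⟩ odd 1 #2 ∙⟨ refl ⟩ odd 2 #4)
                        (even 0 #1 ∙⟨ refl ⟩ even 1 #3) (n≤1+n _) ≤-refl
  ; covers = unhooked-covers
      (left #0 ∙⟨ refl ⟩ right #0 ∙⟨ refl ⟩ left #2 ∙⟨ refl ⟩ left #3 ∙⟨ refl ⟩ left #4 ∙⟨ refl ⟩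
       right #2 ∙⟨ refl ⟩ left #1 ∙⟨ refl ⟩ right #3 ∙⟨ refl ⟩ right #1 ∙⟨ refl ⟩ right #4)
  }
  where
  open Nests (nest 0 0 1 ∷ nest 6 1 1 ∷ nest 2 2 1 ∷ nest 3 3 1 ∷ nest 4 4 1 ∷ [])

-- The first nest carries all even differences and fills the last `4k + 9` positions, except its
-- middle `6k + 11`, where the pair of difference `4k + 7` ends. The other odd differences, with the
-- left end of that pair, fill the positions before: two nests of depth `k` for `3, …, 2k + 1` and
-- `2k + 7, …, 4k + 5`, and single pairs for `1`, `2k + 3`, `2k + 5`.
skolem-4k+8 : ∀ k → Skolem (4 * k + 8) (2 * (4 * k + 8))
skolem-4k+8 k = record
  { pairs  = pairs
  ; size   = trans length-pairs (count k)
  ; diffs  = resize (interleave odds evens ≤-refl (n≤1+n _)) (solve (k ∷ []))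
  ; covers = unhooked-covers covered
  }
  where
  open Nests
    ( nest (4 * k + 7) 1                 (2 * k + 4)
    ∷ nest 0           (2 * (k + 3))     k
    ∷ nest (k + 3)     2                 k
    ∷ nest k           (2 * (k + 2))     1
    ∷ nest (k + 1)     0                 1
    ∷ nest (2 * k + 3) (2 * (k + 1))     1
    ∷ nest (2 * k + 4) (2 * (2 * k + 3)) 1
    ∷ [])

  count : ∀ k → 2 * k + 4 + (k + (k + 4)) ≡ 4 * k + 8
  count = solve-∀

  odds : Run (λ j → Diff pairs (suc (2 * j))) 0 (2 * k + 4)
  odds = resize
    (odd 0 #4 ∙⟨ solve (k ∷ []) ⟩ odd 1 #2 ∙⟨ solve (k ∷ []) ⟩
     odd (k + 1) #5 ∙⟨ solve (k ∷ []) ⟩ odd (k + 2) #3 ∙⟨ solve (k ∷ []) ⟩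
     odd (k + 3) #1 ∙⟨ solve (k ∷ []) ⟩ odd (2 * k + 3) #6)
    (solve (k ∷ []))

  evens : Run (λ j → Diff pairs (2 + 2 * j)) 0 (2 * k + 4)
  evens = even 0 #0

  covered : Run (Pos pairs) 0 (2 * (4 * k + 8))
  covered = resize
    (left #1 ∙⟨ solve (k ∷ []) ⟩ left #3 ∙⟨ solve (k ∷ []) ⟩ left #4 ∙⟨ solve (k ∷ []) ⟩
     right #4 ∙⟨ solve (k ∷ []) ⟩ left #2 ∙⟨ solve (k ∷ []) ⟩ left #5 ∙⟨ solve (k ∷ []) ⟩
     left #6 ∙⟨ solve (k ∷ []) ⟩ right #2 ∙⟨ solve (k ∷ []) ⟩ right #3 ∙⟨ solve (k ∷ []) ⟩
     right #1 ∙⟨ solve (k ∷ []) ⟩ right #5 ∙⟨ solve (k ∷ []) ⟩ left #0 ∙⟨ solve (k ∷ []) ⟩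
     right #6 ∙⟨ solve (k ∷ []) ⟩ right #0)
    (solve (k ∷ []))

-- Again the even differences come last. The middle of their nest, `6k + 13`, receives the right end
-- of the pair of difference `4k + 9`; difference `2k + 5` now belongs to the nest of large odd
-- differences.
skolem-4k+9 : ∀ k → Skolem (4 * k + 9) (2 * (4 * k + 9))
skolem-4k+9 k = record
  { pairs  = pairs
  ; size   = trans length-pairs (count k)
  ; diffs  = resize (interleave odds evens (n≤1+n _) ≤-refl) (solve (k ∷ []))
  ; covers = unhooked-covers covered
  }
  where
  open Nests
    ( nest (4 * k + 9) 1                 (2 * k + 4)
    ∷ nest 0           (2 * (k + 2))     (k + 2)
    ∷ nest (k + 4)     2                 k
    ∷ nest (k + 2)     0                 1
    ∷ nest (2 * k + 4) (2 * (2 * k + 4)) 1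
    ∷ nest (2 * k + 5) (2 * (k + 1))     1
    ∷ [])

  count : ∀ k → 2 * k + 4 + (k + 2 + (k + 3)) ≡ 4 * k + 9
  count = solve-∀

  odds : Run (λ j → Diff pairs (suc (2 * j))) 0 (suc (2 * k + 4))
  odds = resize
    (odd 0 #3 ∙⟨ solve (k ∷ []) ⟩ odd 1 #2 ∙⟨ solve (k ∷ []) ⟩
     odd (k + 1) #5 ∙⟨ solve (k ∷ []) ⟩ odd (k + 2) #1 ∙⟨ solve (k ∷ []) ⟩ odd (2 * k + 4) #4)
    (solve (k ∷ []))

  evens : Run (λ j → Diff pairs (2 + 2 * j)) 0 (2 * k + 4)
  evens = even 0 #0

  covered : Run (Pos pairs) 0 (2 * (4 * k + 9))
  covered = resize
    (left #1 ∙⟨ solve (k ∷ []) ⟩ left #3 ∙⟨ solve (k ∷ []) ⟩ right #3 ∙⟨ solve (k ∷ []) ⟩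
     left #2 ∙⟨ solve (k ∷ []) ⟩ left #4 ∙⟨ solve (k ∷ []) ⟩ left #5 ∙⟨ solve (k ∷ []) ⟩
     right #2 ∙⟨ solve (k ∷ []) ⟩ right #1 ∙⟨ solve (k ∷ []) ⟩ right #5 ∙⟨ solve (k ∷ []) ⟩
     left #0 ∙⟨ solve (k ∷ []) ⟩ right #4 ∙⟨ solve (k ∷ []) ⟩ right #0)
    (solve (k ∷ []))

-- Here the nest of the even differences `2, …, 4k + 4` comes first, and its middle `2k + 2` is the
-- left end of the pair of difference `4k + 5`. The remaining even difference `4k + 6` belongs to
-- the pair that ends on the hook `8k + 12`, just past the hole.
hooked-4k+6 : ∀ k → Skolem (4 * k + 6) (8 * k + 11)
hooked-4k+6 k = record
  { pairs  = pairs
  ; size   = trans length-pairs (count k)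
  ; diffs  = resize (interleave odds evens ≤-refl (n≤1+n _)) (solve (k ∷ []))
  ; covers = hooked-covers covered (subst (Pos pairs) (hook k) (right #5 .at z<s)) (last k)
  }
  where
  open Nests
    ( nest 0           1                       (2 * k + 2)
    ∷ nest (4 * k + 7) (2 * (k + 2))           k
    ∷ nest (5 * k + 7) 2                       k
    ∷ nest (2 * k + 2) (2 * (2 * k + 2))       1
    ∷ nest (4 * k + 5) (2 * (k + 1))           1
    ∷ nest (4 * k + 6) (suc (2 * (2 * k + 2))) 1
    ∷ nest (7 * k + 9) 0                       1
    ∷ [])

  count : ∀ k → 2 * k + 2 + (k + (k + 4)) ≡ 4 * k + 6
  count = solve-∀

  odds : Run (λ j → Diff pairs (suc (2 * j))) 0 (2 * k + 3)
  odds = resize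
    (odd 0 #6 ∙⟨ solve (k ∷ []) ⟩ odd 1 #2 ∙⟨ solve (k ∷ []) ⟩
     odd (k + 1) #4 ∙⟨ solve (k ∷ []) ⟩ odd (k + 2) #1 ∙⟨ solve (k ∷ []) ⟩ odd (2 * k + 2) #3)
    (solve (k ∷ []))

  evens : Run (λ j → Diff pairs (2 + 2 * j)) 0 (2 * k + 3)
  evens = resize (even 0 #0 ∙⟨ solve (k ∷ []) ⟩ even (2 * k + 2) #5) (solve (k ∷ []))

  covered : Run (Pos pairs) 0 (8 * k + 11)
  covered = resize
    (left #0 ∙⟨ solve (k ∷ []) ⟩ left #3 ∙⟨ solve (k ∷ []) ⟩ right #0 ∙⟨ solve (k ∷ []) ⟩
     left #4 ∙⟨ solve (k ∷ []) ⟩ left #5 ∙⟨ solve (k ∷ []) ⟩ left #1 ∙⟨ solve (k ∷ []) ⟩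
     left #2 ∙⟨ solve (k ∷ []) ⟩ right #3 ∙⟨ solve (k ∷ []) ⟩ right #4 ∙⟨ solve (k ∷ []) ⟩
     right #2 ∙⟨ solve (k ∷ []) ⟩ left #6 ∙⟨ solve (k ∷ []) ⟩ right #6 ∙⟨ solve (k ∷ []) ⟩
     right #1)
    (solve (k ∷ []))

  hook : ∀ k → 4 * k + 6 + 1 + suc (2 * (2 * k + 2)) + 0 ≡ suc (8 * k + 11)
  hook = solve-∀

  last : ∀ k → 2 * (4 * k + 6) ≡ suc (8 * k + 11)
  last = solve-∀

-- The even nest is again first, with the left end of difference `4k + 5` in its middle. It now has
-- all even differences, and the pair ending on the hook `8k + 14` has the odd difference `4k + 7`.
hooked-4k+7 : ∀ k → Skolem (4 * k + 7) (8 * k + 13)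
hooked-4k+7 k = record
  { pairs  = pairs
  ; size   = trans length-pairs (count k)
  ; diffs  = resize (interleave odds evens (n≤1+n _) ≤-refl) (solve (k ∷ []))
  ; covers = hooked-covers covered (subst (Pos pairs) (hook k) (right #5 .at z<s)) (last k)
  }
  where
  open Nests
    ( nest 0            1                 (2 * k + 3)
    ∷ nest (4 * k + 8)  (2 * (k + 2))     k
    ∷ nest (5 * k + 8)  2                 k
    ∷ nest (2 * k + 3)  (2 * (2 * k + 2)) 1
    ∷ nest (6 * k + 9)  (2 * (k + 1))     1
    ∷ nest (4 * k + 7)  (2 * (2 * k + 3)) 1
    ∷ nest (7 * k + 10) 0                 1
    ∷ [])

  count : ∀ k → 2 * k + 3 + (k + (k + 4)) ≡ 4 * k + 7
  count = solve-∀

  odds : Run (λ j → Diff pairs (suc (2 * j))) 0 (suc (2 * k + 3))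
  odds = resize
    (odd 0 #6 ∙⟨ solve (k ∷ []) ⟩ odd 1 #2 ∙⟨ solve (k ∷ []) ⟩
     odd (k + 1) #4 ∙⟨ solve (k ∷ []) ⟩ odd (k + 2) #1 ∙⟨ solve (k ∷ []) ⟩
     odd (2 * k + 2) #3 ∙⟨ solve (k ∷ []) ⟩ odd (2 * k + 3) #5)
    (solve (k ∷ []))

  evens : Run (λ j → Diff pairs (2 + 2 * j)) 0 (2 * k + 3)
  evens = even 0 #0

  covered : Run (Pos pairs) 0 (8 * k + 13)
  covered = resize
    (left #0 ∙⟨ solve (k ∷ []) ⟩ left #3 ∙⟨ solve (k ∷ []) ⟩ right #0 ∙⟨ solve (k ∷ []) ⟩
     left #5 ∙⟨ solve (k ∷ []) ⟩ left #1 ∙⟨ solve (k ∷ []) ⟩ left #2 ∙⟨ solve (k ∷ []) ⟩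
     right #3 ∙⟨ solve (k ∷ []) ⟩ left #4 ∙⟨ solve (k ∷ []) ⟩ right #2 ∙⟨ solve (k ∷ []) ⟩
     left #6 ∙⟨ solve (k ∷ []) ⟩ right #6 ∙⟨ solve (k ∷ []) ⟩ right #1 ∙⟨ solve (k ∷ []) ⟩
     right #4)
    (solve (k ∷ []))

  hook : ∀ k → 4 * k + 7 + 1 + 2 * (2 * k + 3) + 0 ≡ suc (8 * k + 13)
  hook = solve-∀

  last : ∀ k → 2 * (4 * k + 7) ≡ suc (8 * k + 13)
  last = solve-∀

quotient : ∀ t {r} → 4 ≤ t → t % 4 ≡ r → ∃ λ k → r + suc k * 4 ≡ t
quotient t 4≤t refl with t / 4 in eq | m≥n⇒m/n>0 {t} {4} 4≤t
... | suc k | _ = k , sym (trans (m≡m%n+[m/n]*n t 4) (cong (λ q → t % 4 + q * 4) eq))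

skolem : ∀ {t} → 4 ≤ t → t % 4 ≡ 0 ⊎ t % 4 ≡ 1 → Skolem t (2 * t)
skolem {t} 4≤t (inj₁ t%4≡0) with quotient t 4≤t t%4≡0
... | zero  , refl = skolem-4
... | suc k , refl = subst (λ t → Skolem t (2 * t)) (eq k) (skolem-4k+8 k)
  where
  eq : ∀ k → 4 * k + 8 ≡ (2 + k) * 4
  eq = solve-∀
skolem {t} 4≤t (inj₂ t%4≡1) with quotient t 4≤t t%4≡1
... | zero  , refl = skolem-5
... | suc k , refl = subst (λ t → Skolem t (2 * t)) (eq k) (skolem-4k+9 k)
  where
  eq : ∀ k → 4 * k + 9 ≡ 1 + (2 + k) * 4
  eq = solve-∀

hooked-skolem : ∀ {t} → 4 ≤ t → t % 4 ≡ 2 ⊎ t % 4 ≡ 3 → ∃ λ h → 2 * t ≡ suc h × Skolem t h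
hooked-skolem {t} 4≤t (inj₁ t%4≡2) with quotient t 4≤t t%4≡2
... | k , refl = 8 * k + 11 , last k , subst (λ t → Skolem t (8 * k + 11)) (eq k) (hooked-4k+6 k)
  where
  last : ∀ k → 2 * (2 + (1 + k) * 4) ≡ suc (8 * k + 11)
  last = solve-∀
  eq : ∀ k → 4 * k + 6 ≡ 2 + (1 + k) * 4
  eq = solve-∀
hooked-skolem {t} 4≤t (inj₂ t%4≡3) with quotient t 4≤t t%4≡3
... | k , refl = 8 * k + 13 , last k , subst (λ t → Skolem t (8 * k + 13)) (eq k) (hooked-4k+7 k)
  where
  last : ∀ k → 2 * (3 + (1 + k) * 4) ≡ suc (8 * k + 13)
  last = solve-∀
  eq : ∀ k → 4 * k + 7 ≡ 3 + (1 + k) * 4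
  eq = solve-∀

-- Labels of the 4-cycles

squareSum : ∀ x d x′ d′ → x + d ≡ x′ + d′ → Square
squareSum x d x′ d′ eq = record
  { nbr₁ = x ; nbr₂ = x′ ; opp = x + d ; inner₁ = d ; inner₂ = d′
  ; side₁ = ∣m-m+n∣≡n x d
  ; side₂ = trans (cong (λ y → ∣ y - x′ ∣) eq) (trans (∣-∣-comm (x′ + d′) x′) (∣m-m+n∣≡n x′ d′))
  }

squareDifference : ∀ y p p′ → Square
squareDifference y p p′ = record
  { nbr₁ = y + p ; nbr₂ = y + p′ ; opp = y ; inner₁ = p ; inner₂ = p′
  ; side₁ = trans (∣-∣-comm (y + p) y) (∣m-m+n∣≡n y p)
  ; side₂ = ∣m-m+n∣≡n y p′
  }

-- Runs are indexed by label minus one, so `labels` concerns `t + 1, …, t + 4s`. In `opposite`, the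
-- first alternative stands for a label in `1, …, t`, which will belong to a triangle edge off the
-- centre.
record Squares (t s : ℕ) : Set where
  field
    cycles   : List Square
    size     : length cycles ≡ s
    labels   : Run (SquareLabel cycles ∘ suc) t (4 * s)
    distinct : AllPairs (λ c d → opp c ≢ opp d) cycles
    opposite : All (λ c → (∃ λ x → x < t × opp c ≡ suc x) ⊎ Inner cycles (opp c)) cycles

run-map : ∀ {P Q : ℕ → Set} {lo n} → (∀ {k} → P k → Q k) → Run P lo n → Run Q lo n
run-map f r .at i<n = f (r .at i<n)

-- Two adjacent labels `t + 2k + 1`, `t + 2k + 2` go on the spokes and two adjacent labels higher by
-- `2a` go off the centre. Pairing them crosswise makes both sums `2t + 2a + 4k + 3`.
low : ℕ → ℕ → ℕ → Square
low t a k = squareSum (suc (t + 2 * k)) (suc (suc (t + 2 * a + 2 * k)))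
                      (suc (t + suc (2 * k))) (suc (t + 2 * a + 2 * k)) eq
  where
  eq : suc (t + 2 * k) + suc (suc (t + 2 * a + 2 * k)) ≡ suc (t + suc (2 * k)) + suc (t + 2 * a + 2 * k)
  eq = solve (t ∷ a ∷ k ∷ [])

lows : ℕ → ℕ → List Square
lows t a = applyUpTo (low t a) a

low-outer : ∀ t a → Run (Outer (lows t a) ∘ suc) t (2 * a)
low-outer t a = resize
  (interleave (run λ i<a → Any.applyUpTo⁺ (low t a) (inj₁ refl) i<a)
              (run λ i<a → Any.applyUpTo⁺ (low t a) (inj₂ refl) i<a) ≤-refl (n≤1+n a))
  (cong (a +_) (sym (+-identityʳ a)))

low-inner : ∀ t a → Run (Inner (lows t a) ∘ suc) (t + 2 * a) (2 * a)
low-inner t a = resize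
  (interleave (run λ i<a → Any.applyUpTo⁺ (low t a) (inj₂ refl) i<a)
              (run λ {i} i<a → Any.applyUpTo⁺ (low t a) (inj₁ (cong suc (sym (+-suc (t + 2 * a) (2 * i))))) i<a)
              ≤-refl (n≤1+n a))
  (cong (a +_) (sym (+-identityʳ a)))

-- The labels `b + 1, …, b + 4q` form four blocks of `q`. As `k` grows, the inner labels descend
-- through the first two blocks and the outer labels ascend through the last two, so the common
-- difference grows by 2 each time.
top : ℕ → ℕ → ℕ → Square
top b q k = squareDifference (suc (q + 2 * k)) (suc (b + (q ∸ suc k))) (suc (b + q + (q ∸ suc k)))

tops : ℕ → ℕ → List Square
tops b q = applyUpTo (top b q) q

top-inner : ∀ b q → Run (Inner (tops b q) ∘ suc) b (2 * q)
top-inner b q = resize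
  (chain
    (run λ j<q → let i , i<q , mirror , _ = reflect j<q in
      Any.applyUpTo⁺ (top b q) (inj₁ (cong (λ h → suc (b + h)) mirror)) i<q)
    (run λ j<q → let i , i<q , mirror , _ = reflect j<q in
      Any.applyUpTo⁺ (top b q) (inj₂ (cong (λ h → suc (b + q + h)) mirror)) i<q)
    refl)
  (cong (q +_) (sym (+-identityʳ q)))

top-outer : ∀ b q → Run (Outer (tops b q) ∘ suc) (b + 2 * q) (2 * q)
top-outer b q = resize
  (chain
    (run λ {k} k<q → Any.applyUpTo⁺ (top b q) (inj₁ (sum₁ b q k (q ∸ suc k) (m∸n+n≡m k<q))) k<q)
    (run λ {k} k<q → Any.applyUpTo⁺ (top b q) (inj₂ (sum₂ b q k (q ∸ suc k) (m∸n+n≡m k<q))) k<q)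
    refl)
  (cong (q +_) (sym (+-identityʳ q)))
  where
  sum₁ : ∀ b q k h → h + suc k ≡ q → suc (q + 2 * k) + suc (b + h) ≡ suc (b + 2 * q + k)
  sum₁ b q k h refl = solve (b ∷ k ∷ h ∷ [])
  sum₂ : ∀ b q k h → h + suc k ≡ q → suc (q + 2 * k) + suc (b + q + h) ≡ suc (b + 2 * q + q + k)
  sum₂ b q k h refl = solve (b ∷ k ∷ h ∷ [])

run-4 : ∀ {P lo} → P (lo + 0) → P (lo + 1) → P (lo + 2) → P (lo + 3) → Run P lo 4
run-4 p₀ p₁ p₂ p₃ .at {0} _ = p₀
run-4 p₀ p₁ p₂ p₃ .at {1} _ = p₁
run-4 p₀ p₁ p₂ p₃ .at {2} _ = p₂
run-4 p₀ p₁ p₂ p₃ .at {3} _ = p₃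
run-4 p₀ p₁ p₂ p₃ .at {suc (suc (suc (suc _)))} (s≤s (s≤s (s≤s (s≤s ()))))

-- Four consecutive labels split into two pairs of difference 1, or into two of difference 2. The
-- term `u + 0` is kept so that `refl` fits the first position in `run-4`.
extra₁ extra₂ : ℕ → Square
extra₁ u = squareDifference 1 (suc (u + 0)) (suc (u + 2))
extra₂ u = squareDifference 2 (suc (u + 0)) (suc (u + 1))

shift : ∀ y u x → y + suc (u + x) ≡ suc (u + (y + x))
shift = solve-∀

extra₁-labels : ∀ u → Run (SquareLabel (extra₁ u ∷ []) ∘ suc) u 4
extra₁-labels u = run-4
  (inj₂ (here (inj₁ refl))) (inj₁ (here (inj₁ (shift 1 u 0))))
  (inj₂ (here (inj₂ refl))) (inj₁ (here (inj₂ (shift 1 u 2))))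

extra₂-labels : ∀ u → Run (SquareLabel (extra₂ u ∷ []) ∘ suc) u 4
extra₂-labels u = run-4
  (inj₂ (here (inj₁ refl))) (inj₂ (here (inj₂ refl)))
  (inj₁ (here (inj₁ (shift 2 u 0)))) (inj₁ (here (inj₂ (shift 2 u 1))))

extras : ℕ → ℕ → List Square
extras u e = take e (extra₁ u ∷ extra₂ (u + 4) ∷ [])

extra-labels : ∀ u {e} → e ≤ 2 → Run (SquareLabel (extras u e) ∘ suc) u (4 * e)
extra-labels u z≤n .at ()
extra-labels u (s≤s z≤n) = extra₁-labels u
extra-labels u (s≤s (s≤s z≤n)) =
  run-map (Sum.map Any.++⁺ˡ Any.++⁺ˡ) (extra₁-labels u) ∙⟨ refl ⟩
  run-map (Sum.map there there) (extra₂-labels (u + 4))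

all-extras : ∀ {P : Square → Set} u e → P (extra₁ u) → P (extra₂ (u + 4)) → All P (extras u e)
all-extras u e p₁ p₂ = All.take⁺ e (p₁ All.∷ p₂ All.∷ All.[])

low-opp : ∀ t a k → opp (low t a k) ≡ suc (2 * (t + a + 1 + 2 * k))
low-opp t a k = eq
  where
  eq : suc (t + 2 * k) + suc (suc (t + 2 * a + 2 * k)) ≡ suc (2 * (t + a + 1 + 2 * k))
  eq = solve (t ∷ a ∷ k ∷ [])

-- The inner labels of `lows` and `tops` together form the unbroken interval
-- `t + 2a + 1, …, t + 4a + 2q`. The bounds on `q` put every opposite label of these cycles into it:
-- the differences run from `q + 1` to `3q - 1`, and the sums are at most `2t + 6a - 1`.
module _ {t a q e : ℕ} (4≤t : 4 ≤ t) (t+2a≤q : t + 2 * a ≤ q) (q≤t+4a+1 : q ≤ suc (t + 4 * a))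
         (parity : a ≡ 0 ⊎ ∃ λ c → q ≡ suc (2 * c)) (e≤2 : e ≤ 2) where

  private
    b u : ℕ
    b = t + 2 * a + 2 * a
    u = b + 2 * q + 2 * q

    all : List Square
    all = lows t a ++ tops b q ++ extras u e

    3≤q : 3 ≤ q
    3≤q = ≤-trans (≤-trans (n≤1+n 3) 4≤t) (≤-trans (m≤m+n t (2 * a)) t+2a≤q)

    inners : Run (Inner all ∘ suc) (t + 2 * a) (2 * a + 2 * q)
    inners = run-map Any.++⁺ˡ (low-inner t a) ∙⟨ refl ⟩
             run-map (Any.++⁺ʳ (lows t a) ∘ Any.++⁺ˡ) (top-inner b q)

    labels : Run (SquareLabel all ∘ suc) t (2 * a + ((2 * a + 2 * q) + (2 * q + 4 * e)))
    labels =
      run-map (inj₁ ∘ Any.++⁺ˡ) (low-outer t a) ∙⟨ refl ⟩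
      run-map inj₂ inners ∙⟨ sym (+-assoc (t + 2 * a) (2 * a) (2 * q)) ⟩
      run-map (inj₁ ∘ Any.++⁺ʳ (lows t a) ∘ Any.++⁺ˡ) (top-outer b q) ∙⟨ refl ⟩
      run-map (Sum.map (Any.++⁺ʳ (lows t a) ∘ Any.++⁺ʳ (tops b q)) (Any.++⁺ʳ (lows t a) ∘ Any.++⁺ʳ (tops b q)))
        (extra-labels u e≤2)

    low≢low : ∀ {i j} → i < j → opp (low t a i) ≢ opp (low t a j)
    low≢low {i} {j} i<j eq = <⇒≢ i<j (*-cancelˡ-≡ i j 2 (+-cancelˡ-≡ (t + a + 1) _ _
      (*-cancelˡ-≡ _ _ 2 (suc-injective (trans (sym (low-opp t a i)) (trans eq (low-opp t a j)))))))

    top≢top : ∀ {i j} → i < j → opp (top b q i) ≢ opp (top b q j)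
    top≢top {i} {j} i<j eq = <⇒≢ i<j (*-cancelˡ-≡ i j 2 (+-cancelˡ-≡ q _ _ (suc-injective eq)))

    low≢top : ∀ {i} j → i < a → opp (low t a i) ≢ opp (top b q j)
    -- The sums are odd by `low-opp`, while the differences `q + 1 + 2j` are even for odd `q`. If
    -- `a` is 0 there are no sums.
    low≢top {i} j i<a eq = [ none , clash ]′ parity
      where
      none : a ≢ 0
      none a≡0 = n≮0 (subst (i <_) a≡0 i<a)

      clash : ¬ ∃ λ c → q ≡ suc (2 * c)
      clash (c , q≡2c+1) = even≢odd (suc (c + j)) (t + a + 1 + 2 * i) (begin
        2 * suc (c + j)             ≡⟨ solve (c ∷ j ∷ []) ⟩
        suc (suc (2 * c) + 2 * j)   ≡⟨ cong (λ q → suc (q + 2 * j)) q≡2c+1 ⟨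
        opp (top b q j)             ≡⟨ eq ⟨
        opp (low t a i)             ≡⟨ low-opp t a i ⟩
        suc (2 * (t + a + 1 + 2 * i)) ∎)
        where open ≡-Reasoning

    low>2 : ∀ i → 2 < opp (low t a i)
    low>2 i = s≤s (≤-trans (s≤s (s≤s z≤n)) (m≤n+m _ (t + 2 * i)))

    top>2 : ∀ i → 2 < opp (top b q i)
    top>2 i = ≤-trans 3≤q (≤-trans (m≤m+n q (2 * i)) (n≤1+n _))

    distinct : AllPairs (λ c d → opp c ≢ opp d) all
    distinct = AllPairs.++⁺ (AllPairs.applyUpTo⁺₁ (low t a) a λ i<j _ → low≢low i<j)
      (AllPairs.++⁺ (AllPairs.applyUpTo⁺₁ (top b q) q λ i<j _ → top≢top i<j)
        (AllPairs.take⁺ e (((λ ()) All.∷ All.[]) AllPairs.∷ All.[] AllPairs.∷ AllPairs.[]))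
        (All.applyUpTo⁺₂ (top b q) q λ i → all-extras u e
          (>⇒≢ (<-trans (n<1+n 1) (top>2 i))) (>⇒≢ (top>2 i))))
      (All.applyUpTo⁺₁ (low t a) a λ {i} i<a → All.++⁺
        (All.applyUpTo⁺₂ (top b q) q λ j → low≢top j i<a)
        (all-extras u e (>⇒≢ (<-trans (n<1+n 1) (low>2 i))) (>⇒≢ (low>2 i))))

    low-opposite : ∀ {i} → i < a → Inner all (opp (low t a i))
    low-opposite {i} i<a = inside inners
      (≤-trans (m≤m+n (t + 2 * a) (2 * i)) (≤-trans (m≤n+m _ 2) (m≤n+m _ (t + 2 * i))))
      (≤-pred (begin
        suc (suc (t + 2 * i + suc (suc (t + 2 * a + 2 * i)))) ≡⟨ solve (t ∷ a ∷ i ∷ []) ⟩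
        t + (t + 2 * a) + 4 * suc i                           ≤⟨ +-mono-≤ (+-monoʳ-≤ t t+2a≤q) (*-monoʳ-≤ 4 i<a) ⟩
        t + q + 4 * a                                         ≤⟨ m≤m+n _ (suc q) ⟩
        t + q + 4 * a + suc q                                 ≡⟨ solve (t ∷ a ∷ q ∷ []) ⟩
        suc (t + 2 * a + (2 * a + 2 * q))                     ∎))
      where open ≤-Reasoning

    top-opposite : ∀ {i} → i < q → Inner all (opp (top b q i))
    top-opposite {i} i<q = inside inners
      (≤-trans t+2a≤q (m≤m+n q (2 * i)))
      (≤-pred (begin
        suc (suc (q + 2 * i))                ≡⟨ solve (q ∷ i ∷ []) ⟩
        q + 2 * suc i                        ≤⟨ +-mono-≤ q≤t+4a+1 (*-monoʳ-≤ 2 i<q) ⟩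
        suc (t + 4 * a) + 2 * q              ≡⟨ solve (t ∷ a ∷ q ∷ []) ⟩
        suc (t + 2 * a + (2 * a + 2 * q))    ∎))
      where open ≤-Reasoning

  squareSystem : ∀ {s} → a + (q + e) ≡ s → Squares t s
  squareSystem refl = record
    { cycles   = all
    ; size     = trans (length-++ (lows t a)) (cong₂ _+_ (length-applyUpTo (low t a) a)
        (trans (length-++ (tops b q)) (cong₂ _+_ (length-applyUpTo (top b q) q) (size e≤2))))
    ; labels   = resize labels (total a q e)
    ; distinct = distinct
    ; opposite = All.++⁺ (All.applyUpTo⁺₁ (low t a) a λ i<a → inj₂ (low-opposite i<a))
        (All.++⁺ (All.applyUpTo⁺₁ (top b q) q λ i<q → inj₂ (top-opposite i<q))
          (all-extras u e (inj₁ (0 , ≤-trans (s≤s z≤n) 4≤t , refl))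
                          (inj₁ (1 , ≤-trans (s≤s (s≤s z≤n)) 4≤t , refl))))
    }
    where
    size : ∀ {e} → e ≤ 2 → length (extras u e) ≡ e
    size z≤n             = refl
    size (s≤s z≤n)       = refl
    size (s≤s (s≤s z≤n)) = refl

    total : ∀ a q e → 2 * a + ((2 * a + 2 * q) + (2 * q + 4 * e)) ≡ 4 * (a + (q + e))
    total = solve-∀

-- Both q = t + v and q = t + v - 1 are admissible for this a, so q can be taken odd.
splitExcess : ∀ r → ∃ λ a → ∃ λ v → a + v ≡ 4 + r × suc (2 * a) ≤ v × v ≤ suc (4 * a)
splitExcess 0 = 1 , 3 , refl , ≤-refl , m≤n+m 3 2
splitExcess 1 = 1 , 4 , refl , n≤1+n 3 , n≤1+n 4
splitExcess 2 = 1 , 5 , refl , m≤n+m 3 2 , ≤-refl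
-- Replacing `a` and `v` by `a + 1` and `v + 2` raises the sum by 3, the lower bound on `v` by 2 and
-- the upper bound by 4.
splitExcess (suc (suc (suc r))) with splitExcess r
... | a , v , a+v≡4+r , 2a<v , v≤4a+1 = suc a , 2 + v ,
  trans (cong suc (trans (+-suc a (suc v)) (cong suc (+-suc a v)))) (cong (3 +_) a+v≡4+r) ,
  ≤-trans (≤-reflexive (cong suc (*-suc 2 a))) (+-monoʳ-≤ 2 2a<v) ,
  ≤-trans (+-mono-≤ (m≤m+n 2 2) v≤4a+1) (≤-reflexive (trans (+-suc 4 (4 * a)) (cong suc (sym (*-suc 4 a)))))

-- With `a = 0` the only choices for `q` are `t` and `t + 1`; here `q = t + 1`, and the `e` cycles
-- left over are extra blocks.
squares-small : ∀ {t} e → 4 ≤ t → e ≤ 2 → Squares t (t + suc e)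
squares-small {t} e 4≤t e≤2 = squareSystem {a = 0} {suc t} {e} 4≤t
  (≤-trans (≤-reflexive (+-identityʳ t)) (n≤1+n t)) (s≤s (m≤m+n t 0)) (inj₁ refl) e≤2 (sym (+-suc t e))

squares : ∀ {t s} → 4 ≤ t → t ≤ s → Squares t s
squares {t} 4≤t t≤s with m≤n⇒∃[o]m+o≡n t≤s
... | 0 , refl = squareSystem {a = 0} {t} {0} 4≤t (≤-reflexive (+-identityʳ t))
  (≤-trans (m≤m+n t 0) (n≤1+n _)) (inj₁ refl) z≤n refl
... | 1 , refl = squares-small 0 4≤t z≤n
... | 2 , refl = squares-small 1 4≤t (s≤s z≤n)
... | 3 , refl = squares-small 2 4≤t ≤-refl
... | suc (suc (suc (suc r))) , refl with splitExcess r
...   | a , suc v , a+1+v≡4+r , s≤s 2a≤v , v≤4a with half (t + v)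
-- Of `t + v` and `t + v + 1` the odd one is taken as `q`. The smaller choice leaves one cycle over,
-- which becomes `extra₁`.
...     | c , inj₂ odd = squareSystem {a = a} {t + v} {1} 4≤t (+-monoʳ-≤ t 2a≤v)
  (≤-trans (+-monoʳ-≤ t (≤-trans (n≤1+n v) v≤4a)) (≤-reflexive (+-suc t (4 * a))))
  (inj₂ (c , odd)) (s≤s z≤n) (trans (total a t v) (cong (t +_) a+1+v≡4+r))
  where
  total : ∀ a t v → a + (t + v + 1) ≡ t + (a + suc v)
  total = solve-∀
...     | c , inj₁ even = squareSystem {a = a} {t + suc v} {0} 4≤t (+-monoʳ-≤ t (≤-trans 2a≤v (n≤1+n v)))
  (≤-trans (+-monoʳ-≤ t v≤4a) (≤-reflexive (+-suc t (4 * a))))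
  (inj₂ (c , trans (+-suc t v) (cong suc even))) z≤n (trans (total a t v) (cong (t +_) a+1+v≡4+r))
  where
  total : ∀ a t v → a + (t + suc v + 0) ≡ t + (a + suc v)
  total = solve-∀

-- Joining triangles and 4-cycles into a labelling

Labelled : ℕ → ℕ → ℕ → Set
Labelled t s h = ∃ λ (f : V t s → ℕ) → Injective _≡_ _≡_ f ×
  (∀ v → f v ≡ 0 ⊎ Range (edgesC3C4 t s) h (f v)) ×
  BijOnto (edgeLabel (C3C4 t s) f) (Range (edgesC3C4 t s) h)

from-lists : ∀ {t s h} T S → length T ≡ t → length S ≡ s → h ≤ edgesC3C4 t s →
             (∀ {k} → Range (edgesC3C4 t s) h k → (Pos T k ⊎ Outer S k) ⊎ (Diff T k ⊎ Inner S k)) →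
             AllPairs (λ c d → opp c ≢ opp d) S → All (λ c → Diff T (opp c) ⊎ Inner S (opp c)) S →
             Labelled t s h
from-lists T S refl refl h≤m cover distinct inner =
  labelling , labelling-injective h≤m cover distinct inner ,
  labelling-range h≤m cover distinct inner , label-bijective h≤m cover distinct inner
  where open Labelling T S

edge-count : ∀ t s → t + 4 * s + 2 * t ≡ 3 * t + 4 * s
edge-count = solve-∀

-- Position `x` of the sequence becomes label `t + 4s + x + 1`, so the hole becomes exactly the
-- label omitted from `Range`.
assemble : ∀ {t s hole} → hole ≤ 2 * t → Skolem t hole → Squares t s → Labelled t s (t + 4 * s + hole)
assemble {t} {s} {hole} hole≤2t sk sq =
  from-lists T cycles (trans (length-map shiftPair pairs) (Skolem.size sk)) (Squares.size sq)
    (≤-trans (+-monoʳ-≤ u hole≤2t) (≤-reflexive (edge-count t s))) cover distinct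
    (All.map (Sum.map₁ λ { (x , x<t , eq) → subst (Diff T) (sym eq) (diff x<t) }) opposite)
  where
  open Skolem sk using (pairs; diffs; covers)
  open Squares sq using (cycles; labels; distinct; opposite)

  u : ℕ
  u = t + 4 * s

  shiftPair : ℕ × ℕ → ℕ × ℕ
  shiftPair (p , d) = suc (u + p) , d

  T : List (ℕ × ℕ)
  T = map shiftPair pairs

  diff : ∀ {x} → x < t → Diff T (suc x)
  diff x<t = Any.map⁺ (diffs .at x<t)

  pos : ∀ {x} → Pos pairs x → Pos T (suc (u + x))
  pos = Any.map⁺ ∘ Any.map λ where
    (inj₁ refl) → inj₁ refl
    (inj₂ refl) → inj₂ (cong suc (+-assoc u _ _))

  cover : ∀ {k} → Range (edgesC3C4 t s) (u + hole) k →
          (Pos T k ⊎ Outer cycles k) ⊎ (Diff T k ⊎ Inner cycles k)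
  cover {suc x} (_ , s≤s x≤m , k≢) with x <? t | x <? u
  ... | yes x<t | _ = inj₂ (inj₁ (diff x<t))
  ... | no x≮t | yes x<u = Sum.map inj₂ inj₂ (inside labels (≮⇒≥ x≮t) x<u)
  ... | no _ | no x≮u with y , refl ← m≤n⇒∃[o]m+o≡n (≮⇒≥ x≮u) =
    inj₁ (inj₁ (pos (covers (+-cancelˡ-≤ u y (2 * t) (≤-trans x≤m (≤-reflexive (sym (edge-count t s)))))
      (k≢ ∘ cong λ x → suc (u + x)))))

BijOnto-resp : ∀ {A : Set} {g : A → ℕ} {P Q : ℕ → Set} → (∀ {k} → P k → Q k) → (∀ {k} → Q k → P k) →
               BijOnto g P → BijOnto g Q
BijOnto-resp P⇒Q Q⇒P (injective , range , onto) = injective , P⇒Q ∘ range , λ k → onto k ∘ Q⇒P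

labelled⇒graceful : ∀ {t s} → Labelled t s (edgesC3C4 t s) → Graceful (C3C4 t s) (edgesC3C4 t s)
labelled⇒graceful {t} {s} (f , f-injective , f-range , bijective) =
  f , f-injective , bounded , BijOnto-resp to from bijective
  where
  m = edgesC3C4 t s

  to : ∀ {k} → Range m m k → 1 ≤ k × k ≤ m
  to (1≤k , k≤1+m , k≢1+m) = 1≤k , ≤-pred (≤∧≢⇒< k≤1+m k≢1+m)

  from : ∀ {k} → 1 ≤ k × k ≤ m → Range m m k
  from (1≤k , k≤m) = 1≤k , m≤n⇒m≤1+n k≤m , <⇒≢ (s≤s k≤m)

  bounded : ∀ v → f v ≤ m
  bounded v with f-range v
  ... | inj₁ fv≡0 = ≤-trans (≤-reflexive fv≡0) z≤n
  ... | inj₂ r    = proj₂ (to r)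

labelled⇒nearGraceful : ∀ {t s h} → edgesC3C4 t s ≡ suc h → Labelled t s h →
                        NearGraceful (C3C4 t s) (edgesC3C4 t s)
labelled⇒nearGraceful {t} {s} {h} m≡1+h (f , f-injective , f-range , bijective) =
  f , f-injective , bounded , inj₂ (BijOnto-resp to from bijective)
  where
  m = edgesC3C4 t s

  h≡m∸1 : h ≡ m ∸ 1
  h≡m∸1 = sym (cong (_∸ 1) m≡1+h)

  to : ∀ {k} → Range m h k → (1 ≤ k × k ≤ m ∸ 1) ⊎ k ≡ suc m
  to {k} (1≤k , k≤1+m , k≢1+h) with k ≟ suc m
  ... | yes k≡1+m = inj₂ k≡1+m
  ... | no  k≢1+m = inj₁ (1≤k , subst (k ≤_) h≡m∸1
    (≤-pred (≤∧≢⇒< (subst (k ≤_) m≡1+h (≤-pred (≤∧≢⇒< k≤1+m k≢1+m))) k≢1+h)))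

  from : ∀ {k} → (1 ≤ k × k ≤ m ∸ 1) ⊎ k ≡ suc m → Range m h k
  from {k} (inj₁ (1≤k , k≤m∸1)) =
    1≤k , m≤n⇒m≤1+n (≤-trans k≤m∸1 (m∸n≤m m 1)) , <⇒≢ (s≤s (subst (k ≤_) (sym h≡m∸1) k≤m∸1))
  from (inj₂ refl) = s≤s z≤n , ≤-refl , λ eq → 1+n≢n (trans (sym m≡1+h) (suc-injective eq))

  bounded : ∀ v → f v ≤ suc m
  bounded v with f-range v
  ... | inj₁ fv≡0             = ≤-trans (≤-reflexive fv≡0) z≤n
  ... | inj₂ (_ , fv≤1+m , _) = fv≤1+m

theorem4p2 : (t s : ℕ) → 4 ≤ t → t ≤ s → 2 * s ≤ 13 * t + 37 →
    ((t % 4 ≡ 0 ⊎ t % 4 ≡ 1) → Graceful (C3C4 t s) (edgesC3C4 t s)) ×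
    ((t % 4 ≡ 2 ⊎ t % 4 ≡ 3) → NearGraceful (C3C4 t s) (edgesC3C4 t s))
theorem4p2 t s 4≤t t≤s _ = graceful , nearGraceful
  where
  graceful : t % 4 ≡ 0 ⊎ t % 4 ≡ 1 → Graceful (C3C4 t s) (edgesC3C4 t s)
  graceful t%4 = labelled⇒graceful
    (subst (Labelled t s) (edge-count t s) (assemble ≤-refl (skolem 4≤t t%4) (squares 4≤t t≤s)))

  nearGraceful : t % 4 ≡ 2 ⊎ t % 4 ≡ 3 → NearGraceful (C3C4 t s) (edgesC3C4 t s)
  nearGraceful t%4 with h , 2t≡1+h , sk ← hooked-skolem 4≤t t%4 =
    -- The hole of the hooked sequence is `h = 2t - 1`, so the omitted label `t + 4s + h + 1` equals
    -- `m`, and `m + 1` is used instead.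
    labelled⇒nearGraceful (begin
      3 * t + 4 * s         ≡⟨ edge-count t s ⟨
      t + 4 * s + 2 * t     ≡⟨ cong (t + 4 * s +_) 2t≡1+h ⟩
      t + 4 * s + suc h     ≡⟨ +-suc (t + 4 * s) h ⟩
      suc (t + 4 * s + h)   ∎)
      (assemble (≤-trans (n≤1+n h) (≤-reflexive (sym 2t≡1+h))) sk (squares 4≤t t≤s))
    where open ≡-Reasoning
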